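{- For all $n\ge 1$, $sat(Q_n,Q_2)<10\cdot 2^n$.
   Context: $Q_n$ is the hypercube on $\{0,1\}^n$ with edges between vertices differing in exactly one coordinate; $Q_2$ is the 4-cycle. A graph $G$ is $(Q_n,Q_2)$-saturated if $G\subseteq Q_n$, $G$ contains no subgraph isomorphic to $Q_2$, and adding any edge of $E(Q_n)\setminus E(G)$ creates such a subgraph. $sat(Q_n,Q_2)$ is the minimum number of edges of a $(Q_n,Q_2)$-saturated graph. -}

module Defs where

open import Level using (0ℓ)
open import Data.Bool.Base using (Bool; true; false)
import Data.Bool.Properties as Bool
open import Data.Fin.Base using (Fin)
import Data.Fin.Properties as Fin
open import Data.List.Base
  using (List; []; _∷_; _++_; map; filter; length; cartesianProductWith)
open import Data.List.Membership.Propositional using (_∈_)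
open import Data.List.Membership.Propositional.Properties
  using (∈-cartesianProductWith⁺)
open import Data.List.Relation.Unary.All using ([]; _∷_)
open import Data.List.Relation.Unary.AllPairs using ([]; _∷_)
open import Data.List.Relation.Unary.Any using (here; there)
open import Data.List.Relation.Unary.Unique.Propositional using (Unique)
import Data.List.Relation.Unary.Unique.Propositional.Properties as Unique
open import Data.Nat.Base using (ℕ; zero; suc; _≤_)
open import Data.Nat.Properties using (≤-antisym)
open import Data.Product using (Σ; ∃-syntax; ∃!; _×_; _,_)
open import Data.Sum.Base using (_⊎_; inj₁; inj₂)
open import Data.Vec.Base as Vec using (Vec; lookup)
import Data.Vec.Properties as Vec
open import Function.Definitions using (Injective)
open import Relation.Binary.Core using (Rel)
open import Relation.Binary.Definitions
  using (DecidableEquality; Decidable; Symmetric; Irreflexive)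
open import Relation.Binary.PropositionalEquality
  using (_≡_; _≢_; refl; sym; trans)
open import Relation.Nullary.Decidable using (Dec; map′; ¬?; _×-dec_; _⊎-dec_; _→-dec_)
open import Relation.Nullary.Negation using (¬_)

record FiniteSet : Set₁ where
  field
    Carrier  : Set
    _≟_      : DecidableEquality Carrier
    elements : List Carrier
    complete : ∀ x → x ∈ elements
    unique   : Unique elements

record Graph (V : FiniteSet) : Set₁ where
  open FiniteSet V using (Carrier)
  field
    Adj    : Rel Carrier 0ℓ
    adj?   : Decidable Adj
    symm   : Symmetric Adj
    irrefl : Irreflexive _≡_ Adj

open FiniteSet using (Carrier; elements)
open Graph using (Adj; adj?; irrefl)

pairs : {A : Set} → List A → List (A × A)
pairs []       = []
pairs (x ∷ xs) = map (x ,_) xs ++ pairs xs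

-- `pairs` keeps only pairs (xᵢ , xⱼ) with i < j, so each edge {x , y} is
-- counted once.
edgeCount : {V : FiniteSet} → Graph V → ℕ
edgeCount {V} G =
  length (filter (λ (x , y) → adj? G x y) (pairs (elements V)))

infix 4 _⊆_

-- Subgraphs are taken on the whole vertex set; isolated vertices are allowed.
_⊆_ : {V : FiniteSet} → Graph V → Graph V → Set
G ⊆ F = ∀ {x y} → Adj G x y → Adj F x y

-- Not necessarily induced: the image of f, with the images of the edges of H,
-- is the subgraph of G isomorphic to H.
Contains : {V W : FiniteSet} → Graph V → Graph W → Set
Contains {V} {W} G H =
  Σ (Carrier W → Carrier V) λ f →
    Injective _≡_ _≡_ f × (∀ {a b} → Adj H a b → Adj G (f a) (f b))

addEdge : {V : FiniteSet} → Graph V → (u v : Carrier V) → u ≢ v → Graph V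
addEdge {V} G u v u≢v = record
  { Adj    = λ x y → Adj G x y ⊎ ((x ≡ u × y ≡ v) ⊎ (x ≡ v × y ≡ u))
  ; adj?   = λ x y → adj? G x y
               ⊎-dec (((x ≟ u) ×-dec (y ≟ v)) ⊎-dec ((x ≟ v) ×-dec (y ≟ u)))
  ; symm   = λ where
      (inj₁ e)                 → inj₁ (Graph.symm G e)
      (inj₂ (inj₁ (p , q)))    → inj₂ (inj₂ (q , p))
      (inj₂ (inj₂ (p , q)))    → inj₂ (inj₁ (q , p))
  ; irrefl = λ where
      x≡y (inj₁ e)                 → irrefl G x≡y e
      x≡y (inj₂ (inj₁ (p , q)))    → u≢v (trans (sym p) (trans x≡y q))
      x≡y (inj₂ (inj₂ (p , q)))    → u≢v (trans (sym q) (trans (sym x≡y) p))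
  }
  where open FiniteSet V using (_≟_)

record Saturated {V W : FiniteSet} (F : Graph V) (H : Graph W) (G : Graph V) : Set where
  field
    subgraph : G ⊆ F
    free     : ¬ Contains G H
    maximal  : ∀ u v (uv : Adj F u v) → ¬ Adj G u v →
               Contains (addEdge G u v (λ u≡v → irrefl F u≡v uv)) H

-- m is the minimum number of edges of an (F , H)-saturated graph.
record IsSat {V W : FiniteSet} (F : Graph V) (H : Graph W) (m : ℕ) : Set₁ where
  field
    attained : ∃[ G ] (Saturated F H G × edgeCount G ≡ m)
    minimal  : ∀ G → Saturated F H G → m ≤ edgeCount G

isSat-unique : {V W : FiniteSet} {F : Graph V} {H : Graph W} {m k : ℕ} →
               IsSat F H m → IsSat F H k → m ≡ k
isSat-unique p q with IsSat.attained p | IsSat.attained q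
... | G , sG , refl | K , sK , refl =
  ≤-antisym (IsSat.minimal p K sK) (IsSat.minimal q G sG)

bitStrings : ∀ n → List (Vec Bool n)
bitStrings zero    = Vec.[] ∷ []
bitStrings (suc n) = cartesianProductWith Vec._∷_ (false ∷ true ∷ []) (bitStrings n)

bitStrings-complete : ∀ {n} (x : Vec Bool n) → x ∈ bitStrings n
bitStrings-complete Vec.[]      = here refl
bitStrings-complete (b Vec.∷ x) =
  ∈-cartesianProductWith⁺ Vec._∷_ (bit b) (bitStrings-complete x)
  where
  bit : ∀ b → b ∈ false ∷ true ∷ []
  bit false = here refl
  bit true  = there (here refl)

bitStrings-unique : ∀ n → Unique (bitStrings n)
bitStrings-unique zero    = [] ∷ []
bitStrings-unique (suc n) =
  Unique.cartesianProductWith⁺ Vec._∷_ Vec.∷-injective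
    (((λ ()) ∷ []) ∷ [] ∷ []) (bitStrings-unique n)

Cube : ℕ → FiniteSet
Cube n = record
  { Carrier  = Vec Bool n
  ; _≟_      = Vec.≡-dec Bool._≟_
  ; elements = bitStrings n
  ; complete = bitStrings-complete
  ; unique   = bitStrings-unique n
  }

DiffersAt : ∀ {n} → Vec Bool n → Vec Bool n → Fin n → Set
DiffersAt x y i = lookup x i ≢ lookup y i

differsAt? : ∀ {n} (x y : Vec Bool n) i → Dec (DiffersAt x y i)
differsAt? x y i = ¬? (lookup x i Bool.≟ lookup y i)

DifferInOne : ∀ {n} → Rel (Vec Bool n) 0ℓ
DifferInOne x y = ∃! _≡_ (DiffersAt x y)

differInOne? : ∀ {n} → Decidable (DifferInOne {n})
differInOne? x y = map′
  (λ (i , d , u) → i , d , λ {j} → u j)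
  (λ (i , d , u) → i , d , λ j → u {j})
  (Fin.any? λ i → differsAt? x y i
     ×-dec Fin.all? λ j → differsAt? x y j →-dec (i Fin.≟ j))

Q : ∀ n → Graph (Cube n)
Q n = record
  { Adj    = DifferInOne
  ; adj?   = differInOne?
  ; symm   = λ (i , d , u) → i , (λ e → d (sym e)) , λ d′ → u (λ e → d′ (sym e))
  ; irrefl = λ { refl (_ , d , _) → d refl }
  }

{-# OPTIONS --safe #-}

-- Split off three disjoint blocks of 2^r coordinates, on each of which a Hamming code lives
-- (one coordinate of the block is redundant); S l x is the syndrome of x in block l, and x is
-- generic if all three syndromes are nonzero. The base graph joins a generic x to the three
-- vertices obtained by correcting one syndrome ("spokes"). Among the vertices with exactly one
-- zero syndrome l it has the edges in direction i outside block l that are assigned to l by the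
-- parity of the remaining coordinates, so that of the two blocks available for i one takes
-- either parity. This graph contains no Q₂, and every cube edge xy between generic vertices
-- would close one: correct the same syndrome of x and y, choosing the block to which the edge
-- between the corrected vertices is assigned. Hence in any saturated graph containing the base a generic vertex has
-- degree at most 3, and the others number at most 2ⁿ Σ 2^(-r), each of degree at most n:
--   2e ≤ 3·2ⁿ + n·2ⁿ·Σ 2^(-r).
-- For 3K ≤ n < 6K with K a power of 2, blocks of sizes K, K, K (if n ≤ 5K) or 2K, K, K (if
-- n > 5K) give e ≤ 9·2ⁿ.

module Submission where

open import Defs
open import Data.Nat.Base using (ℕ; _≥_; _<_; _*_; _^_)
open import Data.Product using (∃-syntax; _×_)

open import Data.Bool.Base using (Bool; true; false; not; _xor_; if_then_else_)
import Data.Bool.Properties as Bool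
open import Data.Empty using (⊥)
open import Data.Fin.Base using (Fin; zero; suc; _↑ˡ_; _↑ʳ_; splitAt; inject≤)
import Data.Fin.Properties as Fin
open import Data.List.Base
  using (List; []; _∷_; _++_; map; filter; length; allFin; cartesianProduct; cartesianProductWith)
import Data.List.Base as List
open import Data.List.Extrema.Nat using (argmin; argmin-all; f[argmin]≤f[xs])
import Data.List.Membership.DecPropositional as DecMembership
open import Data.List.Membership.Propositional using (_∈_)
open import Data.List.Membership.Propositional.Properties
import Data.List.Properties as List
open import Data.List.Relation.Unary.All as All using (All; []; _∷_)
import Data.List.Relation.Unary.All.Properties as All
open import Data.List.Relation.Unary.AllPairs using ([]; _∷_)
open import Data.List.Relation.Unary.Any as Any using (here; there)
open import Data.List.Relation.Unary.Any.Properties using (lookup-index)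
open import Data.List.Relation.Unary.Unique.Propositional using (Unique)
import Data.List.Relation.Unary.Unique.Propositional.Properties as Unique
open import Data.Nat.Base using (zero; suc; _+_; _≤_; s≤s; >-nonZero)
import Data.Nat.Properties as ℕ
open import Data.Nat.Tactic.RingSolver using (solve)
open import Data.Product using (∃; _,_; proj₁; proj₂; swap)
import Data.Product.Properties as Product
open import Data.Sum.Base as Sum using (_⊎_; inj₁; inj₂)
open import Data.Vec.Base as Vec using (Vec; []; _∷_; lookup; updateAt)
import Data.Vec.Properties as Vec
open import Function.Base using (_∘_; id)
open import Relation.Binary.PropositionalEquality
open import Relation.Nullary.Decidable
  using (Dec; yes; no; does; True; False; toWitness; toWitnessFalse; map′; ¬?
        ; _×-dec_; _⊎-dec_; _→-dec_; decidable-stable)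
open import Relation.Nullary.Negation using (¬_; contradiction)
open import Relation.Unary using (Decidable)

open FiniteSet using (Carrier; elements)
open Graph using (Adj; adj?)

-- Counting with lists: injections, sublists, unordered pairs and edges.

lookup-injective : ∀ {A : Set} {xs : List A} → Unique xs → ∀ i j →
                   List.lookup xs i ≡ List.lookup xs j → i ≡ j
lookup-injective (_   ∷ _)  zero    zero    _  = refl
lookup-injective (x∉ ∷ _)  zero    (suc j) eq = contradiction eq (All.lookup x∉ (∈-lookup j))
lookup-injective (x∉ ∷ _)  (suc i) zero    eq = contradiction (sym eq) (All.lookup x∉ (∈-lookup i))
lookup-injective (_   ∷ u)  (suc i) (suc j) eq = cong suc (lookup-injective u i j eq)

index-injective : ∀ {A : Set} {x y : A} {xs : List A} (p : x ∈ xs) (q : y ∈ xs) →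
                  Any.index p ≡ Any.index q → x ≡ y
index-injective {xs = xs} p q eq =
  trans (lookup-index p) (trans (cong (List.lookup xs) eq) (sym (lookup-index q)))

-- Sending the index of an element of `xs` to the index of its image in `ys` is an injection between
-- finite ordinals.
injection⇒length≤ : ∀ {A B : Set} {xs : List A} {ys : List B} (f : A → B) → Unique xs →
                    (∀ {x} → x ∈ xs → f x ∈ ys) →
                    (∀ {x y} → x ∈ xs → y ∈ xs → f x ≡ f y → x ≡ y) →
                    length xs ≤ length ys
injection⇒length≤ {xs = xs} f xs! f∈ f-inj = Fin.injective⇒≤
  {f = λ i → Any.index (f∈ (∈-lookup i))}
  λ {i} {j} eq → lookup-injective xs! i j
    (f-inj (∈-lookup i) (∈-lookup j) (index-injective (f∈ (∈-lookup i)) (f∈ (∈-lookup j)) eq))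

length-cartesianProductWith : ∀ {A B C : Set} (f : A → B → C) xs ys →
  length (cartesianProductWith f xs ys) ≡ length xs * length ys
length-cartesianProductWith f []       ys = refl
length-cartesianProductWith f (x ∷ xs) ys = trans (List.length-++ (map (f x) ys))
  (cong₂ _+_ (List.length-map (f x) ys) (length-cartesianProductWith f xs ys))

sublists : {A : Set} → List A → List (List A)
sublists []       = [] ∷ []
sublists (x ∷ xs) = map (x ∷_) (sublists xs) ++ sublists xs

-- An edge set is a filter of the list of all pairs, so sublists exhaust all graphs up to mutual
-- inclusion and a minimum over graphs becomes a finite search.
filter∈sublists : ∀ {A : Set} {P : A → Set} (P? : Decidable P) xs → filter P? xs ∈ sublists xs
filter∈sublists P? []       = here refl
filter∈sublists P? (x ∷ xs) with does (P? x)
... | true  = ∈-++⁺ˡ (∈-map⁺ (x ∷_) (filter∈sublists P? xs))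
... | false = ∈-++⁺ʳ (map (x ∷_) (sublists xs)) (filter∈sublists P? xs)

∈-pairs⁺ : ∀ {A : Set} {x y : A} {xs} → x ∈ xs → y ∈ xs → x ≢ y →
           (x , y) ∈ pairs xs ⊎ (y , x) ∈ pairs xs
∈-pairs⁺ (here refl) (here refl) x≢y = contradiction refl x≢y
∈-pairs⁺ (here refl) (there y∈)  x≢y = inj₁ (∈-++⁺ˡ (∈-map⁺ _ y∈))
∈-pairs⁺ (there x∈)  (here refl) x≢y = inj₂ (∈-++⁺ˡ (∈-map⁺ _ x∈))
∈-pairs⁺ {xs = z ∷ zs} (there x∈)  (there y∈)  x≢y =
  Sum.map (∈-++⁺ʳ (map (z ,_) zs)) (∈-++⁺ʳ (map (z ,_) zs)) (∈-pairs⁺ x∈ y∈ x≢y)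

∈-pairs⁻ : ∀ {A : Set} {x y : A} xs → (x , y) ∈ pairs xs → x ∈ xs × y ∈ xs
∈-pairs⁻ (z ∷ zs) p with ∈-++⁻ (map (z ,_) zs) p
... | inj₁ q with _ , y∈ , refl ← ∈-map⁻ (z ,_) q = here refl , there y∈
... | inj₂ q with x∈ , y∈ ← ∈-pairs⁻ zs q = there x∈ , there y∈

pairs-unique : ∀ {A : Set} {xs : List A} → Unique xs → Unique (pairs xs)
pairs-unique []                       = []
pairs-unique {xs = x ∷ xs} (x∉ ∷ xs!) =
  Unique.++⁺ (Unique.map⁺ Product.,-injectiveʳ xs!) (pairs-unique xs!) λ where
    (p , q) → case-∈ p q
  where
  case-∈ : ∀ {v} → v ∈ map (x ,_) xs → v ∈ pairs xs → ⊥
  case-∈ p q with _ , _ , refl ← ∈-map⁻ (x ,_) p =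
    All.lookup x∉ (proj₁ (∈-pairs⁻ xs q)) refl

pairs-asym : ∀ {A : Set} {x y : A} {xs} → Unique xs → (x , y) ∈ pairs xs → ¬ (y , x) ∈ pairs xs
pairs-asym {xs = z ∷ zs} (z∉ ∷ zs!) p q
  with ∈-++⁻ (map (z ,_) zs) p | ∈-++⁻ (map (z ,_) zs) q
... | inj₂ p′ | inj₂ q′ = pairs-asym zs! p′ q′
... | inj₁ p′ | inj₂ q′ with _ , _ , refl ← ∈-map⁻ (z ,_) p′ =
  All.lookup z∉ (proj₂ (∈-pairs⁻ zs q′)) refl
... | inj₂ p′ | inj₁ q′ with _ , _ , refl ← ∈-map⁻ (z ,_) q′ =
  All.lookup z∉ (proj₂ (∈-pairs⁻ zs p′)) refl
... | inj₁ p′ | inj₁ q′ with _ , y∈ , refl ← ∈-map⁻ (z ,_) p′ | _ , _ , refl ← ∈-map⁻ (z ,_) q′ =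
  All.lookup z∉ y∈ refl

-- Each edge gives two arcs. `pairs` contains only one orientation of each, so `E` and its reversal
-- are disjoint and together form a duplicate-free list inside `L`.
2*edgeCount≤ : ∀ {V} (G : Graph V) {L : List (Carrier V × Carrier V)} →
               (∀ {x y} → Adj G x y → (x , y) ∈ L) → 2 * edgeCount G ≤ length L
2*edgeCount≤ {V} G {L} adj⇒∈ = begin
  2 * length E                  ≡⟨ cong (length E +_) (ℕ.+-identityʳ _) ⟩
  length E + length E           ≡⟨ cong (length E +_) (List.length-map swap E) ⟨
  length E + length (map swap E) ≡⟨ List.length-++ E ⟨
  length (E ++ map swap E)      ≤⟨ injection⇒length≤ id arcs! arcs∈ (λ _ _ → id) ⟩
  length L                      ∎
  where
  open ℕ.≤-Reasoning
  E : List (Carrier V × Carrier V)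
  E = filter (λ (x , y) → adj? G x y) (pairs (elements V))
  E! : Unique E
  E! = Unique.filter⁺ _ (pairs-unique (FiniteSet.unique V))
  ∈E : ∀ {v} → v ∈ E → v ∈ pairs (elements V) × Adj G (proj₁ v) (proj₂ v)
  ∈E = ∈-filter⁻ (λ (x , y) → adj? G x y) {xs = pairs (elements V)}
  disjoint : ∀ {v} → v ∈ E → v ∈ map swap E → ⊥
  disjoint p q with (_ , _) , r , refl ← ∈-map⁻ swap q =
    pairs-asym (FiniteSet.unique V) (proj₁ (∈E p)) (proj₁ (∈E r))
  arcs! : Unique (E ++ map swap E)
  arcs! = Unique.++⁺ E! (Unique.map⁺ (λ { {_ , _} {_ , _} refl → refl }) E!) λ (p , q) → disjoint p q
  arcs∈ : ∀ {v} → v ∈ E ++ map swap E → v ∈ L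
  arcs∈ p with ∈-++⁻ E p
  ... | inj₁ q = adj⇒∈ (proj₂ (∈E q))
  ... | inj₂ q with (_ , _) , r , refl ← ∈-map⁻ swap q = adj⇒∈ (Graph.symm G (proj₂ (∈E r)))

-- Finite graphs: decidability, minimum and greedy saturation.

all-carrier? : (V : FiniteSet) {P : Carrier V → Set} → Decidable P → Dec (∀ x → P x)
all-carrier? V P? = map′ (λ ps x → All.lookup ps (FiniteSet.complete V x))
                         (λ f → All.tabulate λ {x} _ → f x)
                         (All.all? P? (elements V))

any-carrier? : (V : FiniteSet) {P : Carrier V → Set} → Decidable P → Dec (∃ P)
any-carrier? V P? = map′ Any.satisfied
                         (λ (x , px) → Any.map (λ { refl → px }) (FiniteSet.complete V x))
                         (Any.any? P? (elements V))

Contains-mono : ∀ {V W} {G G′ : Graph V} {H : Graph W} → G ⊆ G′ → Contains G H → Contains G′ H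
Contains-mono G⊆G′ (f , f-inj , f-hom) = f , f-inj , G⊆G′ ∘ f-hom

addEdge-mono : ∀ {V} {G G′ : Graph V} {u v} {p q : u ≢ v} → G ⊆ G′ →
               addEdge G u v p ⊆ addEdge G′ u v q
addEdge-mono G⊆G′ = Sum.map₁ G⊆G′

-- Graphs with the same edges may still differ as records, so saturation is transported along
-- inclusions in both directions instead of an equality.
Saturated-resp : ∀ {V W} {F : Graph V} {H : Graph W} {G G′ : Graph V} →
                 G ⊆ G′ → G′ ⊆ G → Saturated F H G → Saturated F H G′
Saturated-resp {F = F} {H} {G} {G′} G⊆G′ G′⊆G s = record
  { subgraph = λ e → Saturated.subgraph s (G′⊆G e)
  ; free     = λ c → Saturated.free s (Contains-mono {G = G′} {G} {H} G′⊆G c)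
  ; maximal  = λ u v uv ¬e →
      let u≢v = λ u≡v → Graph.irrefl F u≡v uv in
      Contains-mono {G = addEdge G u v u≢v} {addEdge G′ u v u≢v} {H}
        (addEdge-mono {G = G} {G′} {p = u≢v} {u≢v} G⊆G′)
        (Saturated.maximal s u v uv (λ e → ¬e (G⊆G′ e)))
  }

edgeCount-resp : ∀ {V} {G G′ : Graph V} → G ⊆ G′ → G′ ⊆ G → edgeCount G ≡ edgeCount G′
edgeCount-resp {V} {G} {G′} G⊆G′ G′⊆G =
  cong length (List.filter-≐ (λ (x , y) → adj? G x y) (λ (x , y) → adj? G′ x y)
    (G⊆G′ , G′⊆G) (pairs (elements V)))

module _ {V : FiniteSet} where
  open FiniteSet V using (_≟_)
  open DecMembership (Product.≡-dec _≟_ _≟_) using (_∈?_)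

  -- Symmetrising and discarding loops turns any list into a graph, so a search can range over plain
  -- lists of pairs.
  fromPairs : List (Carrier V × Carrier V) → Graph V
  fromPairs es = record
    { Adj    = λ x y → x ≢ y × ((x , y) ∈ es ⊎ (y , x) ∈ es)
    ; adj?   = λ x y → ¬? (x ≟ y) ×-dec ((x , y) ∈? es ⊎-dec (y , x) ∈? es)
    ; symm   = λ (x≢y , p) → x≢y ∘ sym , Sum.swap p
    ; irrefl = λ x≡y (x≢y , _) → x≢y x≡y
    }

  edges : Graph V → List (Carrier V × Carrier V)
  edges G = filter (λ (x , y) → adj? G x y) (pairs (elements V))

  fromPairs-edges⊆ : ∀ G → fromPairs (edges G) ⊆ G
  fromPairs-edges⊆ G (_ , inj₁ p) =
    proj₂ (∈-filter⁻ (λ (x , y) → adj? G x y) {xs = pairs (elements V)} p)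
  fromPairs-edges⊆ G (_ , inj₂ p) = Graph.symm G
    (proj₂ (∈-filter⁻ (λ (x , y) → adj? G x y) {xs = pairs (elements V)} p))

  ⊆fromPairs-edges : ∀ G → G ⊆ fromPairs (edges G)
  ⊆fromPairs-edges G {x} {y} e = x≢y , Sum.map (λ p → ∈-filter⁺ _ p e)
    (λ p → ∈-filter⁺ _ p (Graph.symm G e)) (∈-pairs⁺ (complete x) (complete y) x≢y)
    where
    open FiniteSet V using (complete)
    x≢y : x ≢ y
    x≢y x≡y = Graph.irrefl G x≡y e

module _ {V W : FiniteSet} (F : Graph V) (H : Graph W)
         (contains? : (G : Graph V) → Dec (Contains G H)) where

  saturated? : (G : Graph V) → Dec (Saturated F H G)
  saturated? G = map′
    (λ (s , f , m) → record { subgraph = λ {x} {y} → s x y ; free = f ; maximal = m })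
    (λ s → (λ _ _ → Saturated.subgraph s) , Saturated.free s , Saturated.maximal s)
    (all-carrier? V (λ x → all-carrier? V λ y → adj? G x y →-dec adj? F x y)
      ×-dec ¬? (contains? G)
      ×-dec all-carrier? V (λ u → all-carrier? V (maximal? u)))
    where
    maximal? : ∀ u v → Dec ((uv : Adj F u v) → ¬ Adj G u v →
                 Contains (addEdge G u v (λ u≡v → Graph.irrefl F u≡v uv)) H)
    maximal? u v with adj? F u v
    ... | no ¬uv = yes λ uv → contradiction uv ¬uv
    -- `Adj` of the enlarged graph does not depend on the proof that `u ≢ v`, so a copy found for
    -- one proof of adjacency in `F` serves for every other.
    ... | yes uv = map′ (λ c _ → c) (λ c → c uv)
      (¬? (adj? G u v) →-dec contains? (addEdge G u v (λ u≡v → Graph.irrefl F u≡v uv)))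

  -- Saturation is decidable, so the least edge count can be taken over the finitely many saturated
  -- edge lists; every saturated `K` is represented there by `edges K`.
  isSat-below : (G : Graph V) → Saturated F H G → ∃[ m ] (IsSat F H m × m ≤ edgeCount G)
  isSat-below G sG = size best , record { attained = fromPairs best , best-sat , refl ; minimal = least }
                   , least G sG
    where
    size : List (Carrier V × Carrier V) → ℕ
    size es = edgeCount {V} (fromPairs es)
    sat? : Decidable (λ es → Saturated F H (fromPairs es))
    sat? es = saturated? (fromPairs es)
    candidates : List (List (Carrier V × Carrier V))
    candidates = filter sat? (sublists (pairs (elements V)))
    sat-edges : ∀ K → Saturated F H K → Saturated F H (fromPairs (edges K))
    sat-edges K = Saturated-resp {G = K} {fromPairs (edges K)} (⊆fromPairs-edges K) (fromPairs-edges⊆ K)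
    -- The default of `argmin` is the edge list of the given saturated graph, so the result is
    -- saturated without first showing that there are candidates.
    best : List (Carrier V × Carrier V)
    best = argmin size (edges G) candidates
    best-sat : Saturated F H (fromPairs best)
    best-sat = argmin-all size {edges G} {candidates} {λ es → Saturated F H (fromPairs es)}
      (sat-edges G sG) (All.all-filter sat? (sublists (pairs (elements V))))
    least : ∀ K → Saturated F H K → size best ≤ edgeCount K
    least K sK = ℕ.≤-trans
      (All.lookup (f[argmin]≤f[xs] {f = size} (edges G) candidates)
        (∈-filter⁺ sat? (filter∈sublists _ (pairs (elements V))) (sat-edges K sK)))
      (ℕ.≤-reflexive (edgeCount-resp {G = fromPairs (edges K)} {K} (fromPairs-edges⊆ K) (⊆fromPairs-edges K)))

  private
    MaximalAt : Graph V → Carrier V × Carrier V → Set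
    MaximalAt G (u , v) = (uv : Adj F u v) → ¬ Adj G u v →
      Contains (addEdge G u v (λ u≡v → Graph.irrefl F u≡v uv)) H

    MaximalAt-mono : ∀ {G G′} → G ⊆ G′ → ∀ {e} → MaximalAt G e → MaximalAt G′ e
    MaximalAt-mono {G} {G′} G⊆G′ {u , v} max uv ¬e =
      let u≢v = λ u≡v → Graph.irrefl F u≡v uv in
      Contains-mono {G = addEdge G u v u≢v} {addEdge G′ u v u≢v} {H}
        (addEdge-mono {G = G} {G′} {p = u≢v} {u≢v} G⊆G′) (max uv (¬e ∘ G⊆G′))

    -- Greedy completion: a pair is added unless this creates a copy of `H`. A pair that was
    -- rejected stays maximal when later edges are added, by `MaximalAt-mono`.
    saturateAlong : ∀ es G → G ⊆ F → ¬ Contains G H →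
      ∃[ G′ ] (G ⊆ G′ × G′ ⊆ F × ¬ Contains G′ H × All (MaximalAt G′) es)
    saturateAlong []             G G⊆F free = G , id , G⊆F , free , []
    saturateAlong ((u , v) ∷ es) G G⊆F free with saturateAlong es G G⊆F free
    ... | K , G⊆K , K⊆F , K-free , max with adj? F u v
    ...   | no ¬uv = K , G⊆K , K⊆F , K-free , (λ uv → contradiction uv ¬uv) ∷ max
    ...   | yes uv with contains? (addEdge K u v (λ u≡v → Graph.irrefl F u≡v uv))
    ...     | yes c = K , G⊆K , K⊆F , K-free , (λ _ _ → c) ∷ max
    -- The pair has just become an edge, so maximality at it holds vacuously.
    ...     | no ¬c = K′ , inj₁ ∘ G⊆K , K′⊆F , ¬c
                    , (λ _ ¬e → contradiction (inj₂ (inj₁ (refl , refl))) ¬e)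
                      ∷ All.map (MaximalAt-mono {K} {K′} inj₁) max
      where
      K′ : Graph V
      K′ = addEdge K u v (λ u≡v → Graph.irrefl F u≡v uv)
      K′⊆F : K′ ⊆ F
      K′⊆F (inj₁ e)                    = K⊆F e
      K′⊆F (inj₂ (inj₁ (refl , refl))) = uv
      K′⊆F (inj₂ (inj₂ (refl , refl))) = Graph.symm F uv

  saturate : (G : Graph V) → G ⊆ F → ¬ Contains G H → ∃[ G′ ] (G ⊆ G′ × Saturated F H G′)
  saturate G G⊆F free
    with saturateAlong (cartesianProduct (elements V) (elements V)) G G⊆F free
  ... | K , G⊆K , K⊆F , K-free , max = K , G⊆K , record
    { subgraph = K⊆F
    ; free     = K-free
    ; maximal  = λ u v → All.lookup max
        (∈-cartesianProduct⁺ (FiniteSet.complete V u) (FiniteSet.complete V v))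
    }

-- Copies of the 4-cycle.

private
  pattern 00# = false ∷ false ∷ []
  pattern 01# = false ∷ true ∷ []
  pattern 10# = true ∷ false ∷ []
  pattern 11# = true ∷ true ∷ []

module _ {V : FiniteSet} (G : Graph V) where
  open FiniteSet V using (_≟_)

  -- Only the diagonals need inequalities: adjacent vertices differ by irreflexivity.
  FourCycle : (a b c d : Carrier V) → Set
  FourCycle a b c d =
    a ≢ c × b ≢ d × Adj G a b × Adj G b c × Adj G c d × Adj G d a

  Contains-Q2⇒FourCycle : Contains G (Q 2) →
    ∃[ a ] ∃[ b ] ∃[ c ] ∃[ d ] FourCycle a b c d
  Contains-Q2⇒FourCycle (f , f-inj , f-hom) = f 00# , f 01# , f 11# , f 10#
    , (λ eq → case-≢ (f-inj eq)) , (λ eq → case-≢′ (f-inj eq))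
    , f-hom (edge 00# 01#)
    , f-hom (edge 01# 11#)
    , f-hom (edge 11# 10#)
    , f-hom (edge 10# 00#)
    where
    edge : ∀ x y {xy : True (differInOne? x y)} → DifferInOne x y
    edge x y {xy} = toWitness {a? = differInOne? x y} xy
    case-≢ : 00# ≢ 11#
    case-≢ ()
    case-≢′ : 01# ≢ 10#
    case-≢′ ()

  FourCycle⇒Contains-Q2 : ∀ {a b c d} → FourCycle a b c d → Contains G (Q 2)
  FourCycle⇒Contains-Q2 {a} {b} {c} {d} (a≢c , b≢d , ab , bc , cd , da) =
    f , (λ {x} {y} → f-inj x y) , λ {x} {y} → f-hom x y
    where
    f : Vec Bool 2 → Carrier V
    f 00# = a
    f 01# = b
    f 11# = c
    f 10# = d
    adj⇒≢ : ∀ {x y} → Adj G x y → x ≢ y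
    adj⇒≢ e x≡y = Graph.irrefl G x≡y e
    f-inj : ∀ x y → f x ≡ f y → x ≡ y
    f-inj 00# 00# _  = refl
    f-inj 00# 01# eq = contradiction eq (adj⇒≢ ab)
    f-inj 00# 11# eq = contradiction eq a≢c
    f-inj 00# 10# eq = contradiction (sym eq) (adj⇒≢ da)
    f-inj 01# 00# eq = contradiction (sym eq) (adj⇒≢ ab)
    f-inj 01# 01# _  = refl
    f-inj 01# 11# eq = contradiction eq (adj⇒≢ bc)
    f-inj 01# 10# eq = contradiction eq b≢d
    f-inj 11# 00# eq = contradiction (sym eq) a≢c
    f-inj 11# 01# eq = contradiction (sym eq) (adj⇒≢ bc)
    f-inj 11# 11# _  = refl
    f-inj 11# 10# eq = contradiction eq (adj⇒≢ cd)
    f-inj 10# 00# eq = contradiction eq (adj⇒≢ da)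
    f-inj 10# 01# eq = contradiction (sym eq) b≢d
    f-inj 10# 11# eq = contradiction (sym eq) (adj⇒≢ cd)
    f-inj 10# 10# _  = refl
    non-edge : ∀ x y {¬xy : False (differInOne? x y)} {A : Set} → DifferInOne x y → A
    non-edge x y {¬xy} e = contradiction e (toWitnessFalse {a? = differInOne? x y} ¬xy)
    f-hom : ∀ x y → DifferInOne x y → Adj G (f x) (f y)
    f-hom 00# 00# e = non-edge 00# 00# e
    f-hom 00# 01# _ = ab
    f-hom 00# 11# e = non-edge 00# 11# e
    f-hom 00# 10# _ = Graph.symm G da
    f-hom 01# 00# _ = Graph.symm G ab
    f-hom 01# 01# e = non-edge 01# 01# e
    f-hom 01# 11# _ = bc
    f-hom 01# 10# e = non-edge 01# 10# e
    f-hom 11# 00# e = non-edge 11# 00# e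
    f-hom 11# 01# _ = Graph.symm G bc
    f-hom 11# 11# e = non-edge 11# 11# e
    f-hom 11# 10# _ = cd
    f-hom 10# 00# _ = da
    f-hom 10# 01# e = non-edge 10# 01# e
    f-hom 10# 11# _ = Graph.symm G cd
    f-hom 10# 10# e = non-edge 10# 10# e

  -- A search over four vertices replaces one over maps from the 4-cycle.
  contains-Q2? : Dec (Contains G (Q 2))
  contains-Q2? = map′
    (λ (_ , _ , _ , _ , cycle) → FourCycle⇒Contains-Q2 cycle)
    Contains-Q2⇒FourCycle
    (any-carrier? V λ a → any-carrier? V λ b → any-carrier? V λ c → any-carrier? V λ d →
      ¬? (a ≟ c) ×-dec ¬? (b ≟ d) ×-dec
      adj? G a b ×-dec adj? G b c ×-dec adj? G c d ×-dec adj? G d a)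

-- Hypercube edges as coordinate flips.

flip : ∀ {n} → Fin n → Vec Bool n → Vec Bool n
flip i x = updateAt x i not

module _ {n : ℕ} where

  lookup-flip : ∀ i (x : Vec Bool n) → lookup (flip i x) i ≡ not (lookup x i)
  lookup-flip i x = Vec.lookup∘updateAt i x

  lookup-flip′ : ∀ {i j} (x : Vec Bool n) → i ≢ j → lookup (flip j x) i ≡ lookup x i
  lookup-flip′ x i≢j = Vec.lookup∘updateAt′ _ _ i≢j x

  flip-involutive : ∀ i (x : Vec Bool n) → flip i (flip i x) ≡ x
  flip-involutive i x = trans (Vec.updateAt-updateAt-local i x (Bool.not-involutive _))
                              (Vec.updateAt-id i x)

  flip-comm : ∀ i j (x : Vec Bool n) → flip i (flip j x) ≡ flip j (flip i x)
  flip-comm i j x with i Fin.≟ j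
  ... | yes refl = refl
  ... | no  i≢j  = Vec.updateAt-commutes i j i≢j x

  flip-cancelˡ : ∀ {i j} (x : Vec Bool n) → flip i x ≡ flip j x → i ≡ j
  flip-cancelˡ {i} {j} x eq with i Fin.≟ j
  ... | yes i≡j = i≡j
  ... | no  i≢j = contradiction
    (trans (sym (lookup-flip′ x i≢j)) (trans (cong (λ y → lookup y i) (sym eq)) (lookup-flip i x)))
    (Bool.not-¬ refl)

  flip-cancelʳ : ∀ i {x y : Vec Bool n} → flip i x ≡ flip i y → x ≡ y
  flip-cancelʳ i {x} {y} eq =
    trans (sym (flip-involutive i x)) (trans (cong (flip i) eq) (flip-involutive i y))

  flip-sym : ∀ i {x y : Vec Bool n} → y ≡ flip i x → x ≡ flip i y
  flip-sym i {x} refl = sym (flip-involutive i x)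

  flip≢ : ∀ i (x : Vec Bool n) → flip i x ≢ x
  flip≢ i x eq = Bool.not-¬ refl (trans (cong (λ y → lookup y i) (sym eq)) (lookup-flip i x))

  adj-flip : ∀ i (x : Vec Bool n) → Adj (Q n) x (flip i x)
  adj-flip i x = i , (λ eq → Bool.not-¬ refl (trans eq (lookup-flip i x)))
    , λ {j} d → unique j d
    where
    unique : ∀ j → DiffersAt x (flip i x) j → i ≡ j
    unique j d with i Fin.≟ j
    ... | yes i≡j = i≡j
    ... | no  i≢j = contradiction (sym (lookup-flip′ x (i≢j ∘ sym))) d

  adj⇒flip : ∀ {x y : Vec Bool n} → Adj (Q n) x y → ∃[ i ] y ≡ flip i x
  adj⇒flip {x} {y} (i , d , u) = i , (begin
    y                              ≡⟨ Vec.tabulate∘lookup y ⟨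
    Vec.tabulate (lookup y)        ≡⟨ Vec.tabulate-cong same ⟩
    Vec.tabulate (lookup (flip i x)) ≡⟨ Vec.tabulate∘lookup (flip i x) ⟩
    flip i x                       ∎)
    where
    open ≡-Reasoning
    same : ∀ j → lookup y j ≡ lookup (flip i x) j
    same j with i Fin.≟ j
    ... | yes refl = trans (Bool.¬-not (d ∘ sym)) (sym (lookup-flip i x))
    ... | no  i≢j with lookup x j Bool.≟ lookup y j
    ...   | yes eq = trans (sym eq) (sym (lookup-flip′ x (i≢j ∘ sym)))
    ...   | no  d′ = contradiction (u d′) i≢j

  -- The left route changes coordinate `a` for good, since `c = a` would lead back to `x`. The right
  -- route must change it too, and as `b` is not `a`, its second flip does. Hence opposite edges of
  -- a 4-cycle in the cube have the same direction.
  square : ∀ {a b c d} (x : Vec Bool n) → a ≢ b → flip c (flip a x) ≢ x →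
           flip c (flip a x) ≡ flip d (flip b x) → c ≡ b × d ≡ a
  square {a} {b} {c} {d} x a≢b ≢x eq = c≡b , d≡a
    where
    a≢c : a ≢ c
    a≢c refl = ≢x (flip-involutive a x)
    d≡a : d ≡ a
    d≡a with a Fin.≟ d
    ... | yes a≡d = sym a≡d
    ... | no  a≢d = contradiction
      (trans (trans (sym (lookup-flip′ x a≢b)) (sym (lookup-flip′ (flip b x) a≢d)))
        (trans (cong (λ y → lookup y a) (sym eq))
          (trans (lookup-flip′ (flip a x) a≢c) (lookup-flip a x))))
      (Bool.not-¬ refl)
    c≡b : c ≡ b
    c≡b = flip-cancelˡ (flip a x)
      (trans eq (trans (cong (λ i → flip i (flip b x)) d≡a) (flip-comm a b x)))

  module _ {G : Graph (Cube n)} (G⊆Q : G ⊆ Q n) where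

    Contains-Q2⇒square : Contains G (Q 2) →
      ∃[ x ] ∃[ a ] ∃[ b ] (a ≢ b × Adj G x (flip a x) × Adj G x (flip b x)
        × Adj G (flip a x) (flip b (flip a x)) × Adj G (flip b x) (flip b (flip a x)))
    Contains-Q2⇒square c with Contains-Q2⇒FourCycle G c
    ... | x , y , z , w , x≢z , y≢w , xy , yz , zw , wx
      with adj⇒flip {x} {y} (G⊆Q xy) | adj⇒flip {x} {w} (G⊆Q (Graph.symm G wx))
         | adj⇒flip {y} {z} (G⊆Q yz) | adj⇒flip {w} {z} (G⊆Q (Graph.symm G zw))
    ... | a , refl | b , refl | c , refl | d , eq
      with square x (λ { refl → y≢w refl }) (x≢z ∘ sym) eq
    ... | refl , refl =
      x , a , b , (λ { refl → y≢w refl }) , xy , Graph.symm G wx , yz , Graph.symm G zw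

length-bitStrings : ∀ n → length (bitStrings n) ≡ 2 ^ n
length-bitStrings zero    = refl
length-bitStrings (suc n) =
  trans (length-cartesianProductWith Vec._∷_ (false ∷ true ∷ []) (bitStrings n))
        (cong (2 *_) (length-bitStrings n))

length-allFin : ∀ n → length (allFin n) ≡ n
length-allFin n = List.length-tabulate id

2*edgeCount≤n*2^n : ∀ {n} (G : Graph (Cube n)) → G ⊆ Q n → 2 * edgeCount G ≤ 2 ^ n * n
2*edgeCount≤n*2^n {n} G G⊆Q = ℕ.≤-trans
  (2*edgeCount≤ G {cartesianProductWith (λ x i → x , flip i x) (bitStrings n) (allFin n)} covered)
  (ℕ.≤-reflexive (trans (length-cartesianProductWith _ (bitStrings n) (allFin n))
    (cong₂ _*_ (length-bitStrings n) (length-allFin n))))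
  where
  covered : ∀ {x y} → Adj G x y →
            (x , y) ∈ cartesianProductWith (λ x i → x , flip i x) (bitStrings n) (allFin n)
  covered {x} {y} e with i , refl ← adj⇒flip {x = x} {y} (G⊆Q e) =
    ∈-cartesianProductWith⁺ (λ x i → x , flip i x) (bitStrings-complete x) (∈-allFin i)

-- Binary vectors, syndromes and parities.

infixl 6 _⊕_

_⊕_ : ∀ {r} → Vec Bool r → Vec Bool r → Vec Bool r
_⊕_ = Vec.zipWith _xor_

𝟎 : ∀ {r} → Vec Bool r
𝟎 = Vec.replicate _ false

_≟ᵥ_ : ∀ {r} (z w : Vec Bool r) → Dec (z ≡ w)
_≟ᵥ_ = Vec.≡-dec Bool._≟_

⊕-assoc : ∀ {r} (x y z : Vec Bool r) → (x ⊕ y) ⊕ z ≡ x ⊕ (y ⊕ z)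
⊕-assoc = Vec.zipWith-assoc Bool.xor-assoc

⊕-comm : ∀ {r} (x y : Vec Bool r) → x ⊕ y ≡ y ⊕ x
⊕-comm = Vec.zipWith-comm Bool.xor-comm

⊕-identityˡ : ∀ {r} (x : Vec Bool r) → 𝟎 ⊕ x ≡ x
⊕-identityˡ = Vec.zipWith-identityˡ Bool.xor-identityˡ

⊕-identityʳ : ∀ {r} (x : Vec Bool r) → x ⊕ 𝟎 ≡ x
⊕-identityʳ = Vec.zipWith-identityʳ Bool.xor-identityʳ

⊕-self : ∀ {r} (x : Vec Bool r) → x ⊕ x ≡ 𝟎
⊕-self []      = refl
⊕-self (b ∷ x) = cong₂ _∷_ (Bool.xor-same b) (⊕-self x)

⊕≡𝟎⇒≡ : ∀ {r} (x y : Vec Bool r) → x ⊕ y ≡ 𝟎 → x ≡ y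
⊕≡𝟎⇒≡ x y eq = begin
  x           ≡⟨ ⊕-identityʳ x ⟨
  x ⊕ 𝟎       ≡⟨ cong (x ⊕_) (⊕-self y) ⟨
  x ⊕ (y ⊕ y) ≡⟨ ⊕-assoc x y y ⟨
  (x ⊕ y) ⊕ y ≡⟨ cong (_⊕ y) eq ⟩
  𝟎 ⊕ y       ≡⟨ ⊕-identityˡ y ⟩
  y           ∎
  where open ≡-Reasoning

-- The product of `x` with the parity-check matrix whose columns are the labels.
syndrome : ∀ {n r} → (Fin n → Vec Bool r) → Vec Bool n → Vec Bool r
syndrome label []      = 𝟎
syndrome label (b ∷ x) = (if b then label zero else 𝟎) ⊕ syndrome (label ∘ suc) x

syndrome-flip : ∀ {n r} (label : Fin n → Vec Bool r) i x →
                syndrome label (flip i x) ≡ syndrome label x ⊕ label i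
syndrome-flip label zero (false ∷ x) = let s = syndrome (label ∘ suc) x in
  trans (⊕-comm _ s) (cong (_⊕ label zero) (sym (⊕-identityˡ s)))
syndrome-flip label zero (true ∷ x) = let s = syndrome (label ∘ suc) x in begin
  𝟎 ⊕ s                        ≡⟨ ⊕-comm 𝟎 s ⟩
  s ⊕ 𝟎                        ≡⟨ cong (s ⊕_) (⊕-self (label zero)) ⟨
  s ⊕ (label zero ⊕ label zero) ≡⟨ ⊕-assoc s _ _ ⟨
  (s ⊕ label zero) ⊕ label zero ≡⟨ cong (_⊕ label zero) (⊕-comm s _) ⟩
  (label zero ⊕ s) ⊕ label zero ∎
  where open ≡-Reasoning
syndrome-flip label (suc i) (b ∷ x) =
  trans (cong (_ ⊕_) (syndrome-flip (label ∘ suc) i x)) (sym (⊕-assoc _ _ _))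

parity : ∀ {n} → Vec Bool n → Bool
parity []      = false
parity (b ∷ x) = b xor parity x

parity-flip : ∀ {n} i (x : Vec Bool n) → parity (flip i x) ≡ not (parity x)
parity-flip zero    (b ∷ x) = sym (Bool.not-distribˡ-xor b (parity x))
parity-flip (suc i) (b ∷ x) =
  trans (cong (b xor_) (parity-flip i x)) (sym (Bool.not-distribʳ-xor b (parity x)))

-- The `xor` cancels the contribution of coordinate `i`, leaving the parity of the other
-- coordinates.
coparity : ∀ {n} → Vec Bool n → Fin n → Bool
coparity x i = parity x xor lookup x i

coparity-flip : ∀ {n} i (x : Vec Bool n) → coparity (flip i x) i ≡ coparity x i
coparity-flip i x = begin
  parity (flip i x) xor lookup (flip i x) i ≡⟨ cong₂ _xor_ (parity-flip i x) (lookup-flip i x) ⟩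
  not (parity x) xor not (lookup x i)       ≡⟨ Bool.not-distribˡ-xor (parity x) _ ⟨
  not (parity x xor not (lookup x i))       ≡⟨ cong not (Bool.not-distribʳ-xor (parity x) _) ⟨
  not (not (parity x xor lookup x i))       ≡⟨ Bool.not-involutive _ ⟩
  parity x xor lookup x i                   ∎
  where open ≡-Reasoning

coparity-flip′ : ∀ {n} {i j} (x : Vec Bool n) → i ≢ j → coparity (flip j x) i ≡ not (coparity x i)
coparity-flip′ {i = i} {j} x i≢j =
  trans (cong₂ _xor_ (parity-flip j x) (lookup-flip′ x i≢j)) (sym (Bool.not-distribˡ-xor (parity x) _))

-- The two blocks other than `k`, as `k + 1` and `k + 2` modulo 3; any enumeration of them would do.
hub : Fin 3 → Bool → Fin 3
hub zero             false = suc zero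
hub zero             true  = suc (suc zero)
hub (suc zero)       false = suc (suc zero)
hub (suc zero)       true  = zero
hub (suc (suc zero)) false = zero
hub (suc (suc zero)) true  = suc zero

hub≢ : ∀ k b → hub k b ≢ k
hub≢ zero             false ()
hub≢ zero             true  ()
hub≢ (suc zero)       false ()
hub≢ (suc zero)       true  ()
hub≢ (suc (suc zero)) false ()
hub≢ (suc (suc zero)) true  ()

hub-not : ∀ k b → hub k (not b) ≢ hub k b
hub-not zero             false ()
hub-not zero             true  ()
hub-not (suc zero)       false ()
hub-not (suc zero)       true  ()
hub-not (suc (suc zero)) false ()
hub-not (suc (suc zero)) true  ()

-- The base graph on three disjoint Hamming blocks.

module Construction {n : ℕ} (r : Fin 3 → ℕ) (pos : ∀ l → Vec Bool (r l) → Fin n)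
  (pos-injective : ∀ l {z w} → pos l z ≡ pos l w → z ≡ w)
  (pos-disjoint : ∀ {l m z w} → pos l z ≡ pos m w → l ≡ m)
  where

  private
    V : Set
    V = Vec Bool n
    variable
      x y z w : V
      i a b : Fin n
      l m : Fin 3

  position? : ∀ l i → Dec (∃[ z ] pos l z ≡ i)
  position? l i = any-carrier? (Cube (r l)) (λ z → pos l z Fin.≟ i)

  -- Positions pos l 𝟎, and coordinates that are not positions at all, get the label 𝟎.
  label : ∀ l → Fin n → Vec Bool (r l)
  label l i with position? l i
  ... | yes (z , _) = z
  ... | no  _       = 𝟎

  label-pos : ∀ l z → label l (pos l z) ≡ z
  label-pos l z with position? l (pos l z)
  ... | yes (w , eq) = pos-injective l eq
  ... | no  ¬p       = contradiction (z , refl) ¬p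

  pos-label : ∀ l i → label l i ≢ 𝟎 → pos l (label l i) ≡ i
  pos-label l i ≢𝟎 with position? l i
  ... | yes (_ , eq) = eq
  ... | no  _        = contradiction refl ≢𝟎

  label≢𝟎-unique : label l i ≢ 𝟎 → label m i ≢ 𝟎 → l ≡ m
  label≢𝟎-unique p q = pos-disjoint (trans (pos-label _ _ p) (sym (pos-label _ _ q)))

  label-pos′ : ∀ {z} → m ≢ l → label m (pos l z) ≡ 𝟎
  label-pos′ {m} {l} {z} m≢l = decidable-stable (_ ≟ᵥ 𝟎) λ p → m≢l (pos-disjoint (pos-label m (pos l z) p))

  -- Junk value zero for coordinates with all labels 𝟎: any two hosts serve those.
  block : Fin n → Fin 3
  block i with Fin.any? (λ l → ¬? (label l i ≟ᵥ 𝟎))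
  ... | yes (l , _) = l
  ... | no  _       = zero

  label-block : l ≢ block i → label l i ≡ 𝟎
  label-block {l} {i} l≢ with Fin.any? (λ l → ¬? (label l i ≟ᵥ 𝟎))
  ... | yes (m , p) = decidable-stable (_ ≟ᵥ 𝟎) λ q → l≢ (label≢𝟎-unique q p)
  ... | no  ¬p      = decidable-stable (_ ≟ᵥ 𝟎) λ q → ¬p (l , q)

  -- The block to which the edge at `x` in direction `i` is assigned. Both ends of the edge agree on
  -- it, while a flip in any other direction changes it.
  host : V → Fin n → Fin 3
  host x i = hub (block i) (coparity x i)

  host-flip : ∀ i x → host (flip i x) i ≡ host x i
  host-flip i x = cong (hub (block i)) (coparity-flip i x)

  host-flip′ : ∀ x → a ≢ b → host (flip b x) a ≢ host x a
  host-flip′ {a} x a≢b eq = hub-not (block a) (coparity x a)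
    (trans (cong (hub (block a)) (sym (coparity-flip′ x a≢b))) eq)

  S : ∀ l → V → Vec Bool (r l)
  S l = syndrome (label l)

  S-flip-pos : ∀ l z x → S l (flip (pos l z) x) ≡ S l x ⊕ z
  S-flip-pos l z x = trans (syndrome-flip (label l) (pos l z) x) (cong (S l x ⊕_) (label-pos l z))

  S-flip-𝟎 : ∀ x → label l i ≡ 𝟎 → S l (flip i x) ≡ S l x
  S-flip-𝟎 {l} {i} x eq =
    trans (syndrome-flip (label l) i x) (trans (cong (S l x ⊕_) eq) (⊕-identityʳ _))

  -- The error position of Hamming decoding. For a zero syndrome it is the redundant coordinate
  -- `pos l 𝟎`, whose flip leaves the syndrome zero.
  toward : Fin 3 → V → Fin n
  toward l x = pos l (S l x)

  S-toward : ∀ l x → S l (flip (toward l x) x) ≡ 𝟎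
  S-toward l x = trans (S-flip-pos l (S l x) x) (⊕-self _)

  S-toward′ : ∀ x → m ≢ l → S m (flip (toward l x) x) ≡ S m x
  S-toward′ x m≢l = S-flip-𝟎 x (label-pos′ m≢l)

  -- The flip adds `label l i`, which must therefore equal the syndrome; a nonzero label determines
  -- its coordinate.
  toward-unique : ∀ x → S l x ≢ 𝟎 → S l (flip i x) ≡ 𝟎 → i ≡ toward l x
  toward-unique {l} {i} x ≢𝟎 eq =
    trans (sym (pos-label l i (λ p → ≢𝟎 (trans Sx≡ p)))) (cong (pos l) (sym Sx≡))
    where
    Sx≡ : S l x ≡ label l i
    Sx≡ = ⊕≡𝟎⇒≡ _ _ (trans (sym (syndrome-flip (label l) i x)) eq)

  Generic : V → Set
  Generic x = ∀ l → S l x ≢ 𝟎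

  generic? : ∀ x → Dec (Generic x)
  generic? x = Fin.all? λ l → ¬? (S l x ≟ᵥ 𝟎)

  Only : Fin 3 → V → Set
  Only l x = S l x ≡ 𝟎 × (∀ m → m ≢ l → S m x ≢ 𝟎)

  only? : ∀ l x → Dec (Only l x)
  only? l x = (S l x ≟ᵥ 𝟎) ×-dec Fin.all? λ m → ¬? (m Fin.≟ l) →-dec ¬? (S m x ≟ᵥ 𝟎)

  Only-unique : ∀ x → Only l x → S m x ≡ 𝟎 → m ≡ l
  Only-unique {l} {m} x (_ , p) q = decidable-stable (m Fin.≟ l) λ m≢l → p m m≢l q

  Generic⇒Only : ∀ x → Generic x → Only l (flip (toward l x) x)
  Generic⇒Only {l} x g =
    S-toward l x , λ m m≢l eq → g m (trans (sym (S-toward′ x m≢l)) eq)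

  -- Spokes come in both orientations to make the relation symmetric. `inner` needs no mirror image,
  -- because both ends have the same host in direction `i`.
  data Edge (i : Fin n) (x y : V) : Set where
    spokeˡ : ∀ l → Generic x → y ≡ flip i x → i ≡ toward l x → Edge i x y
    spokeʳ : ∀ l → Generic y → x ≡ flip i y → i ≡ toward l y → Edge i x y
    inner  : y ≡ flip i x → Only (host x i) x → Only (host x i) y → Edge i x y

  edge? : ∀ i x y → Dec (Edge i x y)
  edge? i x y = map′
    (λ { (inj₁ (l , g , p , q)) → spokeˡ l g p q
       ; (inj₂ (inj₁ (l , g , p , q))) → spokeʳ l g p q
       ; (inj₂ (inj₂ (p , q , s))) → inner p q s })
    (λ { (spokeˡ l g p q) → inj₁ (l , g , p , q)
       ; (spokeʳ l g p q) → inj₂ (inj₁ (l , g , p , q))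
       ; (inner p q s) → inj₂ (inj₂ (p , q , s)) })
    ((Fin.any? λ l → generic? x ×-dec (y ≟ᵥ flip i x) ×-dec (i Fin.≟ toward l x))
      ⊎-dec (Fin.any? λ l → generic? y ×-dec (x ≟ᵥ flip i y) ×-dec (i Fin.≟ toward l y))
      ⊎-dec ((y ≟ᵥ flip i x) ×-dec only? (host x i) x ×-dec only? (host x i) y))

  edge-flip : Edge i x y → y ≡ flip i x
  edge-flip (spokeˡ _ _ p _) = p
  edge-flip {i} (spokeʳ _ _ p _) = flip-sym i p
  edge-flip (inner p _ _)    = p

  edge-sym : Edge i x y → Edge i y x
  edge-sym (spokeˡ l g p q) = spokeʳ l g p q
  edge-sym (spokeʳ l g p q) = spokeˡ l g p q
  edge-sym {i} {x} (inner refl p q) = inner (flip-sym i refl)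
    (subst (λ l → Only l (flip i x)) (sym (host-flip i x)) q)
    (subst (λ l → Only l x) (sym (host-flip i x)) p)

  base : Graph (Cube n)
  base = record
    { Adj    = λ x y → ∃[ i ] Edge i x y
    ; adj?   = λ x y → Fin.any? λ i → edge? i x y
    ; symm   = λ (i , e) → i , edge-sym e
    ; irrefl = λ { {x} refl (i , e) → flip≢ i x (sym (edge-flip e)) }
    }

  base⊆Q : base ⊆ Q n
  base⊆Q {x} (i , e) = subst (Adj (Q n) x) (sym (edge-flip e)) (adj-flip i x)

  edge-base : Adj base x (flip i x) → Edge i x (flip i x)
  edge-base {x} {i} (j , e) = subst (λ k → Edge k x (flip i x)) (flip-cancelˡ x (sym (edge-flip e))) e

  ¬Generic×Only : ∀ x → Generic x → ¬ Only l x
  ¬Generic×Only {l} x g (p , _) = g l p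

  -- The other two constructors would give `x` a zero syndrome.
  edge-Generic : Generic x → Edge i x y → ∃[ l ] (i ≡ toward l x × Only l y)
  edge-Generic {x} g (spokeˡ l _ refl refl) = l , refl , Generic⇒Only x g
  edge-Generic {x} {y = y} g (spokeʳ l h refl refl) = contradiction (Generic⇒Only y h) (¬Generic×Only x g)
  edge-Generic {x} {i} g (inner _ p _)  = contradiction p (¬Generic×Only x g)

  edge-Only : ¬ Generic y → Only l x → Edge i x y → host x i ≡ l × Only l y
  edge-Only {y} {l} {x} {i} _ o (inner _ p q) = eq , subst (λ l → Only l y) eq q
    where
    eq : host x i ≡ l
    eq = Only-unique x o (proj₁ p)
  edge-Only {x = x} _ o (spokeˡ _ g _ _) = contradiction o (¬Generic×Only x g)
  edge-Only ¬g _ (spokeʳ _ g _ _) = contradiction g ¬g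

  edge-¬Generic : ¬ Generic x → ¬ Generic y → Edge i x y → Only (host x i) x × Only (host x i) y
  edge-¬Generic ¬g ¬h (spokeˡ _ g _ _) = contradiction g ¬g
  edge-¬Generic ¬g ¬h (spokeʳ _ h _ _) = contradiction h ¬h
  edge-¬Generic ¬g ¬h (inner _ p q)    = p , q

  -- If `x` were generic, `y` and `w` would correct it in distinct blocks `l` and `m`. Direction `b`
  -- lies in block `m`, so `z` inherits the zero `l`-syndrome of `y`. Then `wz` is an inner edge and
  -- `m` is the only block with zero syndrome at `z`, forcing `l ≡ m`.
  square-¬Generic : a ≢ b → Edge a x y → Edge b x w → Edge b y z → Edge a w z → ¬ Generic x
  square-¬Generic {a} {b} {x} {y} {w} {z} a≢b xy xw yz wz g
    with edge-Generic g xy | edge-Generic g xw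
  ... | l , refl , oy | m , refl , ow = contradiction l≡m λ { refl → a≢b refl }
    where
    l≢m : l ≢ m
    l≢m refl = a≢b refl
    Slz : S l z ≡ 𝟎
    Slz = trans (cong (S l) (edge-flip yz)) (trans (S-flip-𝟎 y (label-pos′ l≢m)) (proj₁ oy))
    ¬gz : ¬ Generic z
    ¬gz gz = gz l Slz
    l≡m : l ≡ m
    l≡m = Only-unique z (proj₂ (edge-Only ¬gz ow wz)) Slz

  -- No corner is generic, so all four edges are inner. The single zero syndrome of `x` makes the
  -- hosts of both its edges equal, and that of `flip b x` passes this host on to the opposite edge
  -- in direction `a`. But parallel edges of a square have different hosts.
  base-free : ¬ Contains base (Q 2)
  base-free c with Contains-Q2⇒square {G = base} (λ {x} {y} → base⊆Q {x} {y}) c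
  ... | x , a , b , a≢b , xy′ , xw′ , yz′ , wz′ = host-flip′ x a≢b
    (begin
      host (flip b x) a ≡⟨ proj₁ (edge-Only ¬gz (proj₂ ow) wz) ⟩
      host x b          ≡⟨ Only-unique x (proj₁ oy) (proj₁ (proj₁ ow)) ⟩
      host x a          ∎)
    where
    open ≡-Reasoning
    zw≡ : flip b (flip a x) ≡ flip a (flip b x)
    zw≡ = flip-comm b a x
    xy : Edge a x (flip a x)
    xy = edge-base xy′
    xw : Edge b x (flip b x)
    xw = edge-base xw′
    yz : Edge b (flip a x) (flip b (flip a x))
    yz = edge-base yz′
    wz : Edge a (flip b x) (flip b (flip a x))
    wz = subst (Edge a (flip b x)) (sym zw≡) (edge-base (subst (Adj base (flip b x)) zw≡ wz′))
    -- The same argument for each corner, with the square turned so that the corner comes first.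
    ¬gx : ¬ Generic x
    ¬gx = square-¬Generic a≢b xy xw yz wz
    ¬gy : ¬ Generic (flip a x)
    ¬gy = square-¬Generic a≢b (edge-sym xy) yz xw (edge-sym wz)
    ¬gw : ¬ Generic (flip b x)
    ¬gw = square-¬Generic (a≢b ∘ sym) (edge-sym xw) wz xy (edge-sym yz)
    ¬gz : ¬ Generic (flip b (flip a x))
    ¬gz = square-¬Generic a≢b (edge-sym wz) (edge-sym yz) (edge-sym xw) (edge-sym xy)
    oy : Only (host x a) x × Only (host x a) (flip a x)
    oy = edge-¬Generic ¬gx ¬gy xy
    ow : Only (host x b) x × Only (host x b) (flip b x)
    ow = edge-¬Generic ¬gx ¬gw xw

  generic-detour : ∀ {G : Graph (Cube n)} → base ⊆ G → Generic x → Generic (flip i x) →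
                   Adj G x (flip i x) → Contains G (Q 2)
  generic-detour {x} {i} {G} base⊆G gx gu xy = FourCycle⇒Contains-Q2 G
    ( (λ eq → x≢u′ eq) , x′≢u
    , base⊆G (s , spokeˡ k gx refl refl)
    , base⊆G (i , inner (flip-comm s i x) (subst (λ k → Only k x′) (sym host≡k) (Generic⇒Only x gx))
        (subst (λ k → Only k u′) (sym host≡k)
          (subst (Only k) (cong (λ s → flip s u) (sym s≡)) (Generic⇒Only u gu))))
    , base⊆G (s , spokeʳ k gu refl s≡)
    , Graph.symm G xy )
    where
    u : V
    u = flip i x
    k : Fin 3
    -- The negation anticipates the flip at `s`, which reverses the coparity at `i`: `k` is the host
    -- of direction `i` at `x′`, not at `x`.
    k = hub (block i) (not (coparity x i))
    s : Fin n
    s = toward k x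
    x′ u′ : V
    x′ = flip s x
    u′ = flip s u
    label≡𝟎 : label k i ≡ 𝟎
    label≡𝟎 = label-block (hub≢ (block i) _)
    -- Direction `i` leaves the `k`-syndrome alone, so `x` and `u` are corrected at the same
    -- coordinate and the four vertices form a square.
    s≡ : s ≡ toward k u
    s≡ = cong (pos k) (sym (S-flip-𝟎 x label≡𝟎))
    i≢s : i ≢ s
    i≢s eq = gx k (trans (sym (label-pos k (S k x))) (trans (cong (label k) (sym eq)) label≡𝟎))
    host≡k : host x′ i ≡ k
    host≡k = cong (hub (block i)) (coparity-flip′ x i≢s)
    x≢u′ : x ≢ u′
    x≢u′ eq = i≢s (flip-cancelˡ x (flip-sym s eq))
    x′≢u : x′ ≢ u
    x′≢u eq = i≢s (flip-cancelˡ x (sym eq))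

  -- Code sizes and the degree count.

  Code : Fin 3 → List V
  Code l = filter (λ x → S l x ≟ᵥ 𝟎) (bitStrings n)

  -- The translates of the code by the positions of its block are disjoint.
  code-size : ∀ l → length (Code l) * 2 ^ r l ≤ 2 ^ n
  code-size l = begin
    length (Code l) * 2 ^ r l                         ≡⟨ cong (length (Code l) *_) (length-bitStrings (r l)) ⟨
    length (Code l) * length (bitStrings (r l))       ≡⟨ length-cartesianProductWith _,_ (Code l) (bitStrings (r l)) ⟨
    length (cartesianProduct (Code l) (bitStrings (r l)))
      ≤⟨ injection⇒length≤ translate
           (Unique.cartesianProduct⁺ (Unique.filter⁺ _ (bitStrings-unique n)) (bitStrings-unique (r l)))
           (λ _ → bitStrings-complete _) translate-injective ⟩
    length (bitStrings n)                             ≡⟨ length-bitStrings n ⟩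
    2 ^ n                                             ∎
    where
    open ℕ.≤-Reasoning
    translate : V × Vec Bool (r l) → V
    translate (c , z) = flip (pos l z) c
    S-translate : ∀ {v} → v ∈ cartesianProduct (Code l) (bitStrings (r l)) →
                  S l (translate v) ≡ proj₂ v
    S-translate {c , z} v∈ =
      trans (S-flip-pos l z c) (trans (cong (_⊕ z) c∈) (⊕-identityˡ z))
      where
      c∈ : S l c ≡ 𝟎
      c∈ = proj₂ (∈-filter⁻ (λ x → S l x ≟ᵥ 𝟎) {xs = bitStrings n}
             (proj₁ (∈-cartesianProduct⁻ (Code l) (bitStrings (r l)) v∈)))
    translate-injective : ∀ {v v′} → v ∈ cartesianProduct (Code l) (bitStrings (r l)) →
      v′ ∈ cartesianProduct (Code l) (bitStrings (r l)) → translate v ≡ translate v′ → v ≡ v′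
    translate-injective {c , z} {c′ , z′} v∈ v′∈ eq
      with refl ← trans (sym (S-translate v∈)) (trans (cong (S l) eq) (S-translate v′∈)) =
      cong (_, z) (flip-cancelʳ (pos l z) eq)

  codes : List V
  codes = Code zero ++ Code (suc zero) ++ Code (suc (suc zero))

  ∈-codes : ∀ l → S l x ≡ 𝟎 → x ∈ codes
  ∈-codes {x} zero eq = ∈-++⁺ˡ (∈-filter⁺ _ (bitStrings-complete x) eq)
  ∈-codes {x} (suc zero) eq = ∈-++⁺ʳ (Code zero) (∈-++⁺ˡ (∈-filter⁺ _ (bitStrings-complete x) eq))
  ∈-codes {x} (suc (suc zero)) eq =
    ∈-++⁺ʳ (Code zero) (∈-++⁺ʳ (Code (suc zero)) (∈-filter⁺ _ (bitStrings-complete x) eq))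

  -- Arcs are sorted by their start: a code vertex is allowed all `n` directions. From a generic
  -- vertex an arc must end in a code, by `generic-detour`, and then `toward-unique` identifies it
  -- as one of three. The list `spokes` grants these three arcs to every vertex, which only weakens
  -- the bound.
  2*edgeCount≤spokes+codes : ∀ {G} → base ⊆ G → Saturated (Q n) (Q 2) G →
    2 * edgeCount G ≤ 2 ^ n * 3 + length codes * n
  2*edgeCount≤spokes+codes {G} base⊆G sat = ℕ.≤-trans (2*edgeCount≤ G covered) (ℕ.≤-reflexive
    (trans (List.length-++ spokes) (cong₂ _+_
      (trans (length-cartesianProductWith _ (bitStrings n) (allFin 3)) (cong (_* 3) (length-bitStrings n)))
      (trans (length-cartesianProductWith _ codes (allFin n)) (cong (length codes *_) (length-allFin n))))))
    where
    spokes others : List (V × V)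
    spokes = cartesianProductWith (λ x l → x , flip (toward l x) x) (bitStrings n) (allFin 3)
    others = cartesianProductWith (λ x i → x , flip i x) codes (allFin n)
    covered : ∀ {x y} → Adj G x y → (x , y) ∈ spokes ++ others
    covered {x} {y} e with i , refl ← adj⇒flip {x = x} {y} (Saturated.subgraph sat e)
      with Fin.any? (λ l → S l x ≟ᵥ 𝟎)
    ... | yes (l , eq) = ∈-++⁺ʳ spokes
      (∈-cartesianProductWith⁺ (λ x i → x , flip i x) (∈-codes l eq) (∈-allFin i))
    ... | no ¬x with Fin.any? (λ l → S l (flip i x) ≟ᵥ 𝟎)
    ...   | yes (l , eq) = ∈-++⁺ˡ (subst (λ j → (x , flip j x) ∈ spokes)
      (sym (toward-unique x (λ p → ¬x (l , p)) eq))
      (∈-cartesianProductWith⁺ (λ x l → x , flip (toward l x) x) (bitStrings-complete x) (∈-allFin l)))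
    ...   | no ¬y = contradiction
      (generic-detour {G = G} base⊆G (λ l p → ¬x (l , p)) (λ l p → ¬y (l , p)) e) (Saturated.free sat)

-- Laying out disjoint blocks of coordinates.

total : ∀ {t} → (Fin t → ℕ) → ℕ
total {zero}  k = 0
total {suc t} k = k zero + total (k ∘ suc)

place : ∀ {t} (k : Fin t → ℕ) l → Fin (k l) → Fin (total k)
place k zero    i = i ↑ˡ total (k ∘ suc)
place k (suc l) i = k zero ↑ʳ place (k ∘ suc) l i

↑ˡ≢↑ʳ : ∀ {m n} (i : Fin m) (j : Fin n) → i ↑ˡ n ≢ m ↑ʳ j
↑ˡ≢↑ʳ {m} {n} i j eq
  with trans (sym (Fin.splitAt-↑ˡ m i n)) (trans (cong (splitAt m) eq) (Fin.splitAt-↑ʳ m n j))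
... | ()

place-disjoint : ∀ {t} (k : Fin t → ℕ) l m {i j} → place k l i ≡ place k m j → l ≡ m
place-disjoint k zero    zero    eq = refl
place-disjoint k zero    (suc m) eq = contradiction eq (↑ˡ≢↑ʳ _ _)
place-disjoint k (suc l) zero    eq = contradiction (sym eq) (↑ˡ≢↑ʳ _ _)
place-disjoint k (suc l) (suc m) eq =
  cong suc (place-disjoint (k ∘ suc) l m (Fin.↑ʳ-injective (k zero) _ _ eq))

place-injective : ∀ {t} (k : Fin t → ℕ) l {i j} → place k l i ≡ place k l j → i ≡ j
place-injective k zero    eq = Fin.↑ˡ-injective _ _ _ eq
place-injective k (suc l) eq = place-injective (k ∘ suc) l (Fin.↑ʳ-injective (k zero) _ _ eq)

-- `c l` stands for the size of the code of block `l`. Keeping only its bound separates the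
-- arithmetic from the construction.
Sparse : (n : ℕ) → (Fin 3 → ℕ) → Set₁
Sparse n r = ∃[ G ] (Saturated (Q n) (Q 2) G × ∃[ c ]
  ((∀ l → c l * 2 ^ r l ≤ 2 ^ n) × 2 * edgeCount G ≤ 2 ^ n * 3 + total {3} c * n))

module _ {n : ℕ} (r : Fin 3 → ℕ) (fits : total (λ l → length (bitStrings (r l))) ≤ n) where

  private
    -- Using the list length rather than `2 ^ r l` makes an index into `bitStrings` a place in the
    -- block without transport.
    size : Fin 3 → ℕ
    size l = length (bitStrings (r l))

    place′ : ∀ l → Vec Bool (r l) → Fin (total size)
    place′ l z = place size l (Any.index (bitStrings-complete z))

    pos : ∀ l → Vec Bool (r l) → Fin n
    pos l z = inject≤ (place′ l z) fits

    pos-injective : ∀ l {z w} → pos l z ≡ pos l w → z ≡ w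
    pos-injective l {z} {w} eq = index-injective (bitStrings-complete z) (bitStrings-complete w)
      (place-injective size l (Fin.inject≤-injective fits fits (place′ l z) (place′ l w) eq))

    pos-disjoint : ∀ {l m z w} → pos l z ≡ pos m w → l ≡ m
    pos-disjoint {l} {m} {z} {w} eq = place-disjoint size l m
      (Fin.inject≤-injective fits fits (place′ l z) (place′ m w) eq)

    module C = Construction r pos pos-injective (λ {l} {m} {z} {w} → pos-disjoint {l} {m} {z} {w})

  sparse-saturated : Sparse n r
  sparse-saturated =
    bound (saturate (Q n) (Q 2) contains-Q2? C.base (λ {x} {y} → C.base⊆Q {x} {y}) C.base-free)
    where
    codes-length : length C.codes ≡ total {3} (λ l → length (C.Code l))
    codes-length = trans (List.length-++ (C.Code zero)) (cong (length (C.Code zero) +_)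
      (trans (List.length-++ (C.Code (suc zero))) (cong (length (C.Code (suc zero)) +_)
        (sym (ℕ.+-identityʳ _)))))
    bound : ∃[ G ] (C.base ⊆ G × Saturated (Q n) (Q 2) G) → Sparse n r
    bound (G , base⊆G , sat) = G , sat , (λ l → length (C.Code l)) , C.code-size
      , ℕ.≤-trans (C.2*edgeCount≤spokes+codes {G} (λ {x} {y} → base⊆G {x} {y}) sat)
          (ℕ.≤-reflexive (cong (λ s → 2 ^ n * 3 + s * n) codes-length))

-- Choice of the block sizes and the final estimate.

blockSize : ∀ n → 3 ≤ n → ∃[ r ] (3 * 2 ^ r ≤ n × n < 6 * 2 ^ r)
blockSize (suc n) (s≤s 2≤n) with 3 ℕ.≤? n
-- The argument is exactly 3, served by three blocks of one coordinate.
... | no 3≰n with refl ← ℕ.≤-antisym 2≤n (ℕ.≤-pred (ℕ.≰⇒> 3≰n)) = 0 , ℕ.≤-refl , ℕ.m≤m+n 4 2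
... | yes 3≤n with blockSize n 3≤n
...   | r , lo , hi with suc n ℕ.<? 6 * 2 ^ r
...     | yes hi′ = r , ℕ.m≤n⇒m≤1+n lo , hi′
-- The upper end of the range for `r` has been reached; it is the lower end of the range for
-- `suc r`.
...     | no ¬hi = suc r , ℕ.≤-reflexive (sym n≡) , ℕ.≤-<-trans (ℕ.≤-reflexive n≡)
    (ℕ.*-monoˡ-< (2 ^ suc r) {{ℕ.m^n≢0 2 (suc r)}} (ℕ.m≤m+n 4 2))
  where
  n≡ : suc n ≡ 3 * 2 ^ suc r
  n≡ = trans (ℕ.≤-antisym hi (ℕ.≮⇒≥ ¬hi)) (ℕ.*-assoc 3 2 (2 ^ r))

-- The factor `2 * K` clears the denominators of the code densities. The code term then contributes
-- at most `w * v` times `N * K`, so the hypothesis on `2 * e` gives 4eK at most 36NK, that is, `e`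
-- at most `9 * N`.
weigh : ∀ {e N K C n} w v → w * v ≤ 30 → 0 < N → 0 < K → 2 * e ≤ N * 3 + C * n →
        C * (2 * K) ≤ w * N → n ≤ v * K → e < 10 * N
weigh {e} {N} {K} {C} {n} w v wv≤30 0<N 0<K 2e≤ CK≤ n≤ = ℕ.≰⇒> λ 10N≤e → ℕ.<⇒≱ 36<40 (begin
  40 * (N * K)                         ≡⟨ solve (N List.∷ K List.∷ List.[]) ⟩
  2 * (10 * N) * (2 * K)               ≤⟨ ℕ.*-monoˡ-≤ (2 * K) (ℕ.*-monoʳ-≤ 2 10N≤e) ⟩
  2 * e * (2 * K)                      ≤⟨ ℕ.*-monoˡ-≤ (2 * K) 2e≤ ⟩
  (N * 3 + C * n) * (2 * K)            ≡⟨ solve (N List.∷ K List.∷ C List.∷ n List.∷ List.[]) ⟩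
  6 * (N * K) + C * (2 * K) * n        ≤⟨ ℕ.+-monoʳ-≤ (6 * (N * K)) (ℕ.*-mono-≤ CK≤ n≤) ⟩
  6 * (N * K) + w * N * (v * K)        ≡⟨ solve (N List.∷ K List.∷ w List.∷ v List.∷ List.[]) ⟩
  6 * (N * K) + w * v * (N * K)        ≤⟨ ℕ.+-monoʳ-≤ (6 * (N * K)) (ℕ.*-monoˡ-≤ (N * K) wv≤30) ⟩
  6 * (N * K) + 30 * (N * K)           ≡⟨ ℕ.*-distribʳ-+ (N * K) 6 30 ⟨
  36 * (N * K)                         ∎)
  where
  open ℕ.≤-Reasoning
  36<40 : 36 * (N * K) < 40 * (N * K)
  36<40 = ℕ.*-monoˡ-< (N * K) {{>-nonZero (ℕ.*-mono-< 0<N 0<K)}} (ℕ.m≤m+n 37 3)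

-- Three codes of density at most 1/K: together 6/(2K).
equal-weights : ∀ {N} K (c : Fin 3 → ℕ) → (∀ l → c l * K ≤ N) → total c * (2 * K) ≤ 6 * N
equal-weights {N} K c c≤ = lemma (c zero) (c (suc zero)) (c (suc (suc zero))) (c≤ _) (c≤ _) (c≤ _)
  where
  open ℕ.≤-Reasoning
  lemma : ∀ p q r → p * K ≤ N → q * K ≤ N → r * K ≤ N → (p + (q + (r + 0))) * (2 * K) ≤ 6 * N
  lemma p q r pK≤ qK≤ rK≤ = begin
    (p + (q + (r + 0))) * (2 * K) ≡⟨ solve (p List.∷ q List.∷ r List.∷ K List.∷ List.[]) ⟩
    2 * (p * K + (q * K + r * K)) ≤⟨ ℕ.*-monoʳ-≤ 2 (ℕ.+-mono-≤ pK≤ (ℕ.+-mono-≤ qK≤ rK≤)) ⟩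
    2 * (N + (N + N))             ≡⟨ solve (N List.∷ List.[]) ⟩
    6 * N                         ∎

-- Doubling one block lowers the total density to 1/(2K) + 1/K + 1/K = 5/(2K).
unequal-weights : ∀ {N} K (c : Fin 3 → ℕ) → c zero * (2 * K) ≤ N → (∀ l → c (suc l) * K ≤ N) →
                  total c * (2 * K) ≤ 5 * N
unequal-weights {N} K c c₀≤ c≤ = lemma (c zero) (c (suc zero)) (c (suc (suc zero))) c₀≤ (c≤ _) (c≤ _)
  where
  open ℕ.≤-Reasoning
  lemma : ∀ p q r → p * (2 * K) ≤ N → q * K ≤ N → r * K ≤ N →
          (p + (q + (r + 0))) * (2 * K) ≤ 5 * N
  lemma p q r pK≤ qK≤ rK≤ = begin
    (p + (q + (r + 0))) * (2 * K)     ≡⟨ solve (p List.∷ q List.∷ r List.∷ K List.∷ List.[]) ⟩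
    p * (2 * K) + 2 * (q * K + r * K) ≤⟨ ℕ.+-mono-≤ pK≤ (ℕ.*-monoʳ-≤ 2 (ℕ.+-mono-≤ qK≤ rK≤)) ⟩
    N + 2 * (N + N)                   ≡⟨ solve (N List.∷ List.[]) ⟩
    5 * N                             ∎

FewEdges : ℕ → Set₁
FewEdges n = ∃[ G ] (Saturated (Q n) (Q 2) G × edgeCount G < 10 * 2 ^ n)

module _ {n : ℕ} where
  open ℕ.≤-Reasoning

  -- Three nonempty blocks do not fit here, but the degree bound `n` suffices for any saturated
  -- graph, such as a completion of the empty one.
  fewEdges-small : n ≤ 2 → FewEdges n
  fewEdges-small n≤2 = bound (saturate (Q n) (Q 2) contains-Q2? (fromPairs {Cube n} [])
    (λ { (_ , inj₁ ()) ; (_ , inj₂ ()) }) empty-free)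
    where
    empty-free : ¬ Contains (fromPairs {Cube n} []) (Q 2)
    empty-free c with Contains-Q2⇒FourCycle (fromPairs {Cube n} []) c
    ... | _ , _ , _ , _ , _ , _ , (_ , inj₁ ()) , _
    ... | _ , _ , _ , _ , _ , _ , (_ , inj₂ ()) , _
    bound : ∃[ G ] (fromPairs {Cube n} [] ⊆ G × Saturated (Q n) (Q 2) G) → FewEdges n
    bound (G , _ , sat) = G , sat , ℕ.*-cancelˡ-< 2 _ _ (begin-strict
      2 * edgeCount G  ≤⟨ 2*edgeCount≤n*2^n G (Saturated.subgraph sat) ⟩
      2 ^ n * n        ≤⟨ ℕ.*-monoʳ-≤ (2 ^ n) n≤2 ⟩
      2 ^ n * 2        <⟨ ℕ.*-monoʳ-< (2 ^ n) {{ℕ.m^n≢0 2 n}} (ℕ.m≤m+n 3 17) ⟩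
      2 ^ n * 20       ≡⟨ ℕ.*-comm (2 ^ n) 20 ⟩
      20 * 2 ^ n       ≡⟨ ℕ.*-assoc 2 10 (2 ^ n) ⟩
      2 * (10 * 2 ^ n) ∎)

  fewEdges-equal : ∀ k → 3 * 2 ^ k ≤ n → n ≤ 5 * 2 ^ k → FewEdges n
  fewEdges-equal k 3K≤n n≤5K = bound (sparse-saturated exponent
    (ℕ.≤-trans (ℕ.≤-reflexive (cong (3 *_) (length-bitStrings k))) 3K≤n))
    where
    exponent : Fin 3 → ℕ
    exponent _ = k
    bound : Sparse n exponent → FewEdges n
    bound (G , sat , c , c≤ , e≤) = G , sat , weigh {C = total {3} c} 6 5 ℕ.≤-refl
      (ℕ.m^n>0 2 n) (ℕ.m^n>0 2 k) e≤ (equal-weights (2 ^ k) c c≤) n≤5K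

  -- One block of size 2K and two of size K occupy 4K coordinates. The weight 5 in place of 6 pays
  -- for the larger range of `n`: both cases give the product 30 required by `weigh`.
  fewEdges-unequal : ∀ k → 4 * 2 ^ k ≤ n → n ≤ 6 * 2 ^ k → FewEdges n
  fewEdges-unequal k 4K≤n n≤6K = bound (sparse-saturated exponent fits)
    where
    exponent : Fin 3 → ℕ
    exponent zero    = suc k
    exponent (suc _) = k
    fits : total (λ l → length (bitStrings (exponent l))) ≤ n
    fits = begin
      length (bitStrings (suc k)) + 2 * length (bitStrings k)
        ≡⟨ cong₂ _+_ (length-bitStrings (suc k)) (cong (2 *_) (length-bitStrings k)) ⟩
      2 * 2 ^ k + 2 * 2 ^ k ≡⟨ ℕ.*-distribʳ-+ (2 ^ k) 2 2 ⟨
      4 * 2 ^ k             ≤⟨ 4K≤n ⟩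
      n                     ∎
    bound : Sparse n exponent → FewEdges n
    bound (G , sat , c , c≤ , e≤) = G , sat , weigh {C = total {3} c} 5 6 ℕ.≤-refl
      (ℕ.m^n>0 2 n) (ℕ.m^n>0 2 k) e≤ (unequal-weights (2 ^ k) c (c≤ zero) (c≤ ∘ suc)) n≤6K

fewEdges : ∀ n → FewEdges n
fewEdges n with 3 ℕ.≤? n
... | no 3≰n = fewEdges-small (ℕ.≤-pred (ℕ.≰⇒> 3≰n))
... | yes 3≤n with blockSize n 3≤n
...   | k , lo , hi with n ℕ.≤? 5 * 2 ^ k
...     | yes n≤5K = fewEdges-equal k lo n≤5K
...     | no n≰5K = fewEdges-unequal k
  (ℕ.≤-trans (ℕ.*-monoˡ-≤ (2 ^ k) (ℕ.m≤m+n 4 1)) (ℕ.<⇒≤ (ℕ.≰⇒> n≰5K))) (ℕ.<⇒≤ hi)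

theorem3 : (n : ℕ) → n ≥ 1 → ∃[ m ] (IsSat (Q n) (Q 2) m × m < 10 * 2 ^ n)
theorem3 n _ = least (fewEdges n)
  where
  below : ∀ {e} → e < 10 * 2 ^ n → ∃[ m ] (IsSat (Q n) (Q 2) m × m ≤ e) →
          ∃[ m ] (IsSat (Q n) (Q 2) m × m < 10 * 2 ^ n)
  below e< (m , isSat , m≤e) = m , isSat , ℕ.≤-<-trans m≤e e<
  least : FewEdges n → ∃[ m ] (IsSat (Q n) (Q 2) m × m < 10 * 2 ^ n)
  least (G , sat , few) = below few (isSat-below (Q n) (Q 2) contains-Q2? G sat)
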